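{- Let $r \in \mathbb{N}$. Then $\mathsf{D}_2(C_2^r) < (3r + 6)/2$.
   Context: $C_2^r$ is the elementary abelian $2$-group of rank $r$. A sequence over a finite abelian group $G$ is a finite unordered list of elements of $G$ with repetitions allowed; it is zero-sum if its terms sum to $0$. $\mathsf{D}_k(G)$ is the smallest integer $\ell$ such that every sequence over $G$ of length at least $\ell$ has $k$ disjoint non-empty zero-sum subsequences. -}

module Defs where

open import Algebra.Bundles using (AbelianGroup)
import Algebra.Construct.Pointwise as Pointwise
open import Data.Fin.Base using (Fin)
open import Data.List.Base using (List; []; _++_; concat; foldr; length)
import Data.List.Relation.Binary.Permutation.Setoid as Permutation
open import Data.List.Relation.Unary.All using (All)
open import Data.Nat.Base using (ℕ; _≤_)
open import Data.Parity.Properties using (+-0-abelianGroup)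
open import Data.Product.Base using (_×_; ∃-syntax)
open import Level using (0ℓ; _⊔_)
open import Relation.Binary.PropositionalEquality.Core using (_≡_; _≢_)

-- Functions Fin r → Parity under pointwise addition, where Parity is ℤ/2ℤ;
-- the underlying equality is pointwise equality.
C₂^ : ℕ → AbelianGroup 0ℓ 0ℓ
C₂^ r = Pointwise.abelianGroup (Fin r) +-0-abelianGroup

module _ {c ℓ} (G : AbelianGroup c ℓ) where
  open AbelianGroup G
  open Permutation setoid using (_↭_)

  -- An unordered sequence over G is a list considered up to _↭_.
  Sequence : Set c
  Sequence = List Carrier

  ZeroSum : Sequence → Set ℓ
  ZeroSum T = foldr _∙_ ε T ≈ ε

  -- Subsequences T₁ , … , Tₖ of S are disjoint when they use different terms of
  -- S, i.e. when T₁ ⋯ Tₖ U = S as unordered sequences for some U.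
  HasDisjointZeroSums : ℕ → Sequence → Set (c ⊔ ℓ)
  HasDisjointZeroSums k S =
    ∃[ Ts ] length Ts ≡ k
          × All (λ T → T ≢ [] × ZeroSum T) Ts
          × ∃[ U ] concat Ts ++ U ↭ S

  AllLongHaveDisjointZeroSums : ℕ → ℕ → Set (c ⊔ ℓ)
  AllLongHaveDisjointZeroSums k n =
    (S : Sequence) → n ≤ length S → HasDisjointZeroSums k S

  -- IsD k d means that D_k(G) exists and equals d.  For k ≥ 1 restricting to
  -- natural numbers loses nothing, since the empty sequence excludes every
  -- bound ≤ 0.
  IsD : ℕ → ℕ → Set (c ⊔ ℓ)
  IsD k d = AllLongHaveDisjointZeroSums k d
          × (∀ n → AllLongHaveDisjointZeroSums k n → d ≤ n)

{-# OPTIONS --safe #-}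
module Submission where

-- The zero-sum subsequences of S, |S| = n, form a binary linear code of
-- dimension at least n − r, and every set of r + 1 coordinates contains the
-- support of a nonzero codeword.  Put k = n − r, so that 3r + 4 ≤ 2n gives
-- r + 2 ≤ 2(k − 1), and let c be a nonzero codeword of minimal weight.
-- If |c| < k, the complement of c supports a second codeword.  Otherwise a
-- codeword b avoiding k − 1 elements of c satisfies |b ∩ c| ≤ |c| − (k − 1), so
-- the codeword e = b + c has weight |b| + |c| − 2|b ∩ c| ≥ 2(k − 1) ≥ r + 2.
-- Hence some nonzero codeword a is properly contained in e, and a and e + a
-- are disjoint.

open import Defs
open import Algebra.Bundles using (AbelianGroup)
open import Data.Bool.Base using (Bool; true; false; _xor_)
import Data.Bool.Properties as Bool
open import Data.Empty using (⊥-elim)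
open import Data.Fin.Base using (Fin; zero; suc)
import Data.Fin.Properties as Fin
open import Data.Fin.Subset using (Subset; ⊥; ⊤; _⊆_; _∩_; _∪_; ∁; ∣_∣)
open import Data.Fin.Subset.Properties
open import Data.Integer.Base using (+_)
import Data.Integer.Base as ℤ
import Data.Integer.Properties as ℤ
open import Data.List.Base using (List; []; _∷_; _++_; length; foldr; take; drop; concat)
import Data.List.Properties as List
open import Data.List.Relation.Unary.All using ([]; _∷_)
import Data.List.Relation.Binary.Equality.Setoid as ListEquality
import Data.List.Relation.Binary.Permutation.Setoid as Permutation
import Data.List.Relation.Binary.Permutation.Setoid.Properties as PermutationProperties
open import Data.List.Relation.Binary.Pointwise.Base using ([]; _∷_)
open import Data.Nat.Base using (ℕ; zero; suc; _+_; _*_; _∸_; z≤n; s≤s; z<s; ⌈_/2⌉)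
import Data.Nat.Base as ℕ
open import Data.Nat.Induction using (<-wellFounded)
open import Data.Nat.Properties hiding (_≟_)
open import Data.Nat.Tactic.RingSolver using (solve-∀)
open import Data.Parity.Base using (Parity; 0ℙ; 1ℙ)
import Data.Parity.Base as ℙ
import Data.Parity.Properties as ℙ
open import Data.Product.Base using (_×_; _,_; ∃-syntax; Σ-syntax)
open import Data.Rational.Base using (_/_; _<_)
import Data.Rational.Properties as ℚ
import Data.Rational.Unnormalised.Base as ℚᵘ
import Data.Rational.Unnormalised.Properties as ℚᵘ
open import Data.Sum.Base using ([_,_]′; inj₁; inj₂)
open import Data.Vec.Base using ([]; _∷_; zipWith; here)
import Data.Vec.Properties as Vec
open import Function.Base using (_∘_)
open import Induction.WellFounded using (Acc; acc)
open import Level using (Level; _⊔_)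
open import Relation.Binary.Definitions using () renaming (Decidable to Decidable₂)
open import Relation.Binary.PropositionalEquality
  using (_≡_; _≢_; refl; sym; trans; cong; cong₂; subst; subst₂; module ≡-Reasoning)
open import Relation.Nullary using (Dec; yes; no)
open import Relation.Nullary.Decidable using (map′; _×-dec_)
open import Relation.Unary using (Decidable)

private
  variable
    p : Level
    m n r : ℕ

-- Symmetric difference and cardinalities

infixl 6 _△_

_△_ : Subset n → Subset n → Subset n
_△_ = zipWith _xor_

△-identityˡ : (x : Subset n) → ⊥ △ x ≡ x
△-identityˡ = Vec.zipWith-identityˡ Bool.xor-identityˡ

∣p∪q∣+∣p∩q∣≡∣p∣+∣q∣ : (x y : Subset n) → ∣ x ∪ y ∣ + ∣ x ∩ y ∣ ≡ ∣ x ∣ + ∣ y ∣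
∣p∪q∣+∣p∩q∣≡∣p∣+∣q∣ []          []          = refl
∣p∪q∣+∣p∩q∣≡∣p∣+∣q∣ (true  ∷ x) (true  ∷ y) = cong suc
  (trans (+-suc ∣ x ∪ y ∣ ∣ x ∩ y ∣) (trans (cong suc (∣p∪q∣+∣p∩q∣≡∣p∣+∣q∣ x y)) (sym (+-suc ∣ x ∣ ∣ y ∣))))
∣p∪q∣+∣p∩q∣≡∣p∣+∣q∣ (true  ∷ x) (false ∷ y) = cong suc (∣p∪q∣+∣p∩q∣≡∣p∣+∣q∣ x y)
∣p∪q∣+∣p∩q∣≡∣p∣+∣q∣ (false ∷ x) (true  ∷ y) =
  trans (cong suc (∣p∪q∣+∣p∩q∣≡∣p∣+∣q∣ x y)) (sym (+-suc ∣ x ∣ ∣ y ∣))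
∣p∪q∣+∣p∩q∣≡∣p∣+∣q∣ (false ∷ x) (false ∷ y) = ∣p∪q∣+∣p∩q∣≡∣p∣+∣q∣ x y

∣p△q∣+∣p∩q∣≡∣p∪q∣ : (x y : Subset n) → ∣ x △ y ∣ + ∣ x ∩ y ∣ ≡ ∣ x ∪ y ∣
∣p△q∣+∣p∩q∣≡∣p∪q∣ []          []          = refl
∣p△q∣+∣p∩q∣≡∣p∪q∣ (true  ∷ x) (true  ∷ y) = trans (+-suc ∣ x △ y ∣ ∣ x ∩ y ∣) (cong suc (∣p△q∣+∣p∩q∣≡∣p∪q∣ x y))
∣p△q∣+∣p∩q∣≡∣p∪q∣ (true  ∷ x) (false ∷ y) = cong suc (∣p△q∣+∣p∩q∣≡∣p∪q∣ x y)
∣p△q∣+∣p∩q∣≡∣p∪q∣ (false ∷ x) (true  ∷ y) = cong suc (∣p△q∣+∣p∩q∣≡∣p∪q∣ x y)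
∣p△q∣+∣p∩q∣≡∣p∪q∣ (false ∷ x) (false ∷ y) = ∣p△q∣+∣p∩q∣≡∣p∪q∣ x y

∣p△q∣+2∣p∩q∣≡∣p∣+∣q∣ : (x y : Subset n) → ∣ x △ y ∣ + (∣ x ∩ y ∣ + ∣ x ∩ y ∣) ≡ ∣ x ∣ + ∣ y ∣
∣p△q∣+2∣p∩q∣≡∣p∣+∣q∣ x y = begin
  ∣ x △ y ∣ + (∣ x ∩ y ∣ + ∣ x ∩ y ∣)  ≡⟨ +-assoc ∣ x △ y ∣ _ _ ⟨
  ∣ x △ y ∣ + ∣ x ∩ y ∣ + ∣ x ∩ y ∣    ≡⟨ cong (_+ ∣ x ∩ y ∣) (∣p△q∣+∣p∩q∣≡∣p∪q∣ x y) ⟩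
  ∣ x ∪ y ∣ + ∣ x ∩ y ∣                ≡⟨ ∣p∪q∣+∣p∩q∣≡∣p∣+∣q∣ x y ⟩
  ∣ x ∣ + ∣ y ∣                        ∎
  where open ≡-Reasoning

disjoint-⊆⇒∣p∣+∣q∣≤∣s∣ : (x y z : Subset n) → x ∩ y ≡ ⊥ → x ⊆ z → y ⊆ z → ∣ x ∣ + ∣ y ∣ ℕ.≤ ∣ z ∣
disjoint-⊆⇒∣p∣+∣q∣≤∣s∣ {n} x y z x∩y≡⊥ x⊆z y⊆z = begin
  ∣ x ∣ + ∣ y ∣          ≡⟨ ∣p∪q∣+∣p∩q∣≡∣p∣+∣q∣ x y ⟨
  ∣ x ∪ y ∣ + ∣ x ∩ y ∣  ≡⟨ cong₂ _+_ refl (trans (cong ∣_∣ x∩y≡⊥) (∣⊥∣≡0 n)) ⟩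
  ∣ x ∪ y ∣ + 0          ≡⟨ +-identityʳ _ ⟩
  ∣ x ∪ y ∣              ≤⟨ p⊆q⇒∣p∣≤∣q∣ ([ x⊆z , y⊆z ]′ ∘ x∈p∪q⁻ x y) ⟩
  ∣ z ∣                  ∎
  where open ≤-Reasoning

p⊆∁q⇒p∩q≡⊥ : {x y : Subset n} → x ⊆ ∁ y → x ∩ y ≡ ⊥
p⊆∁q⇒p∩q≡⊥ {x = x} {y} x⊆∁y = Empty-unique λ (_ , i∈) →
  let i∈x , i∈y = x∈p∩q⁻ x y i∈ in x∈∁p⇒x∉p (x⊆∁y i∈x) i∈y

-- For `x` inside `y`, the symmetric difference is the set difference of `y` and `x`. This splits a
-- codeword into two disjoint ones.
p⊆q⇒p∩[p△q]≡⊥ : (x y : Subset n) → x ⊆ y → x ∩ (x △ y) ≡ ⊥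
p⊆q⇒p∩[p△q]≡⊥ []          []          _   = refl
p⊆q⇒p∩[p△q]≡⊥ (true  ∷ x) (true  ∷ y) x⊆y = cong (false ∷_) (p⊆q⇒p∩[p△q]≡⊥ x y (drop-∷-⊆ x⊆y))
p⊆q⇒p∩[p△q]≡⊥ (true  ∷ x) (false ∷ y) x⊆y with () ← x⊆y {zero} here
p⊆q⇒p∩[p△q]≡⊥ (false ∷ x) (_     ∷ y) x⊆y = cong (false ∷_) (p⊆q⇒p∩[p△q]≡⊥ x y (drop-∷-⊆ x⊆y))

subsetOfSize : ∀ m (x : Subset n) → m ℕ.≤ ∣ x ∣ → ∃[ t ] t ⊆ x × ∣ t ∣ ≡ m
subsetOfSize {n} zero x      _           = ⊥ , ⊆-min x , ∣⊥∣≡0 n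
subsetOfSize (suc m) (true  ∷ x) (s≤s m≤∣x∣) =
  let t , t⊆x , ∣t∣≡m = subsetOfSize m x m≤∣x∣ in true ∷ t , in⊆in t⊆x , cong suc ∣t∣≡m
subsetOfSize (suc m) (false ∷ x) m<∣x∣       =
  let t , t⊆x , ∣t∣≡m = subsetOfSize (suc m) x m<∣x∣ in false ∷ t , out⊆ t⊆x , ∣t∣≡m

-- Linear algebra over the field with two elements

odd : Parity → Bool
odd 0ℙ = false
odd 1ℙ = true

odd-+ : ∀ p q → odd (p ℙ.+ q) ≡ odd p xor odd q
odd-+ 0ℙ q  = refl
odd-+ 1ℙ 0ℙ = refl
odd-+ 1ℙ 1ℙ = refl

Linear : (Subset m → Subset n) → Set
Linear f = ∀ x y → f (x △ y) ≡ f x △ f y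

LinearForm : (Subset m → Parity) → Set
LinearForm φ = ∀ x y → φ (x △ y) ≡ φ x ℙ.+ φ y

-- A hyperplane of F₂^(1+m), parametrised by F₂^m; that weights do not decrease
-- is a convenient form of injectivity.
hyperplane : (φ : Subset (suc m) → Parity) → LinearForm φ →
             ∃[ K ] Linear {m} K × (∀ x → ∣ x ∣ ℕ.≤ ∣ K x ∣) × (∀ x → φ (K x) ≡ 0ℙ)
hyperplane {zero}  φ φ-lin = (λ _ → ⊥) , (λ _ _ → refl) , (λ { [] → z≤n }) , λ _ →
  trans (φ-lin ⊥ ⊥) (ℙ.p+p≡0ℙ (φ ⊥))
hyperplane {suc m} φ φ-lin with φ (true ∷ ⊥) in φe
-- `φ` is nonzero on the first basis vector, so its kernel is a graph: the first coordinate is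
-- determined by the remaining ones.
... | 1ℙ = (λ x → odd (φ (false ∷ x)) ∷ x)
         , (λ x y → cong (_∷ x △ y) (trans (cong odd (φ-lin (false ∷ x) (false ∷ y)))
                                           (odd-+ (φ (false ∷ x)) (φ (false ∷ y)))))
         , (λ x → ∣p∣≤∣x∷p∣ (odd (φ (false ∷ x))) x)
         , vanishes
  where
  vanishes : ∀ x → φ (odd (φ (false ∷ x)) ∷ x) ≡ 0ℙ
  vanishes x with φ (false ∷ x) in φx
  ... | 0ℙ = φx
  ... | 1ℙ = begin
    φ (true ∷ x)                      ≡⟨ cong (φ ∘ (true ∷_)) (△-identityˡ x) ⟨
    φ ((true ∷ ⊥) △ (false ∷ x))      ≡⟨ φ-lin (true ∷ ⊥) (false ∷ x) ⟩
    φ (true ∷ ⊥) ℙ.+ φ (false ∷ x)    ≡⟨ cong₂ ℙ._+_ φe φx ⟩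
    0ℙ                                ∎
    where open ≡-Reasoning
-- `φ` ignores the first coordinate, which therefore stays free; the recursion treats the form on
-- the others.
... | 0ℙ with K , K-lin , K-wt , φK ← hyperplane (φ ∘ (false ∷_)) (λ x y → φ-lin (false ∷ x) (false ∷ y))
    = (λ { (b ∷ x) → b ∷ K x })
    , (λ { (b ∷ x) (b′ ∷ y) → cong ((b xor b′) ∷_) (K-lin x y) })
    , (λ { (true ∷ x) → s≤s (K-wt x) ; (false ∷ x) → K-wt x })
    , (λ { (false ∷ x) → φK x
         ; (true ∷ x) → trans (cong (φ ∘ (true ∷_)) (sym (△-identityˡ (K x))))
                       (trans (φ-lin (true ∷ ⊥) (false ∷ K x)) (cong₂ ℙ._+_ φe (φK x))) })

-- Induction on the number of forms: restricting to a hyperplane on which form `zero` vanishes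
-- lowers the dimension by one and leaves `r` forms. Since `K` does not decrease weights, a nonzero
-- solution stays nonzero.
commonZero : ∀ r (φ : Subset m → Fin r → Parity) → (∀ j → LinearForm (λ x → φ x j)) → r ℕ.< m →
             ∃[ x ] 0 ℕ.< ∣ x ∣ × (∀ j → φ x j ≡ 0ℙ)
commonZero {suc m} zero    φ φ-lin _         = ⊤ , subst (0 ℕ.<_) (sym (∣⊤∣≡n (suc m))) z<s , λ ()
commonZero {suc m} (suc r) φ φ-lin (s≤s r<m)
  with K , K-lin , K-wt , φ₀K ← hyperplane (λ x → φ x zero) (φ-lin zero)
  with x , 0<∣x∣ , φx ← commonZero r (λ x j → φ (K x) (suc j))
         (λ j x y → trans (cong (λ z → φ z (suc j)) (K-lin x y)) (φ-lin (suc j) (K x) (K y))) r<m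
  = K x , <-≤-trans 0<∣x∣ (K-wt x) , λ { zero → φ₀K x ; (suc j) → φx j }

-- Identifies the vectors supported on `M` with a full space of dimension `∣ M ∣`, where the
-- dimension count of `commonZero` applies.
embed : (M : Subset n) → Subset ∣ M ∣ → Subset n
embed []          x       = []
embed (true  ∷ M) (b ∷ x) = b ∷ embed M x
embed (false ∷ M) x       = false ∷ embed M x

embed-linear : (M : Subset n) → Linear (embed M)
embed-linear []          x       y        = refl
embed-linear (true  ∷ M) (b ∷ x) (b′ ∷ y) = cong ((b xor b′) ∷_) (embed-linear M x y)
embed-linear (false ∷ M) x       y        = cong (false ∷_) (embed-linear M x y)

embed-⊆ : (M : Subset n) (x : Subset ∣ M ∣) → embed M x ⊆ M
embed-⊆ []          x           ()
embed-⊆ (true  ∷ M) (true  ∷ x) = in⊆in (embed-⊆ M x)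
embed-⊆ (true  ∷ M) (false ∷ x) = out⊆ (embed-⊆ M x)
embed-⊆ (false ∷ M) x           = out⊆ (embed-⊆ M x)

∣embed∣ : (M : Subset n) (x : Subset ∣ M ∣) → ∣ embed M x ∣ ≡ ∣ x ∣
∣embed∣ []          []          = refl
∣embed∣ (true  ∷ M) (true  ∷ x) = cong suc (∣embed∣ M x)
∣embed∣ (true  ∷ M) (false ∷ x) = ∣embed∣ M x
∣embed∣ (false ∷ M) x           = ∣embed∣ M x

commonZeroInside : (φ : Subset n → Fin r → Parity) → (∀ j → LinearForm (λ x → φ x j)) →
                   ∀ M → r ℕ.< ∣ M ∣ → ∃[ x ] x ⊆ M × 0 ℕ.< ∣ x ∣ × (∀ j → φ x j ≡ 0ℙ)
commonZeroInside φ φ-lin M r<∣M∣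
  with x , 0<∣x∣ , φx ← commonZero _ (φ ∘ embed M)
         (λ j x y → trans (cong (λ z → φ z j) (embed-linear M x y)) (φ-lin j (embed M x) (embed M y))) r<∣M∣
  = embed M x , embed-⊆ M x , subst (0 ℕ.<_) (sym (∣embed∣ M x)) 0<∣x∣ , φx

-- Intersecting codes

∣p∣≤k⇒r<∣∁p∣ : ∀ {k} (x : Subset (suc r + k)) → ∣ x ∣ ℕ.≤ k → r ℕ.< ∣ ∁ x ∣
∣p∣≤k⇒r<∣∁p∣ {r} {k} x ∣x∣≤k = begin
  suc r                    ≡⟨ m+n∸n≡m (suc r) k ⟨
  suc r + k ∸ k            ≤⟨ ∸-monoʳ-≤ (suc r + k) ∣x∣≤k ⟩
  suc r + k ∸ ∣ x ∣        ≡⟨ ∣∁p∣≡n∸∣p∣ x ⟨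
  ∣ ∁ x ∣                  ∎
  where open ≤-Reasoning

-- The length is written as `suc r + k`, so `k` here is one less than the k of the opening overview.
-- `Code` is an abstract linear code, and `dense` is the property that any `r + 1` coordinates
-- support a nonzero codeword.
module _ {r k} (Code : Subset (suc r + k) → Set)
         (△-closed : ∀ {x y} → Code x → Code y → Code (x △ y))
         (dense : ∀ M → r ℕ.< ∣ M ∣ → ∃[ x ] x ⊆ M × 0 ℕ.< ∣ x ∣ × Code x)
         (r+2≤2k : 2 + r ℕ.≤ k + k) where

  private
    Pair : Set
    Pair = ∃[ x ] ∃[ y ] 0 ℕ.< ∣ x ∣ × 0 ℕ.< ∣ y ∣ × x ∩ y ≡ ⊥ × Code x × Code y

  -- Some nonzero codeword `a` lives on `r + 1` coordinates of `e`. It cannot exhaust `e`, so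
  -- `a △ e` is the nonempty rest of `e`.
  heavyCodeword⇒disjoint : ∀ {e} → Code e → 2 + r ℕ.≤ ∣ e ∣ → Pair
  heavyCodeword⇒disjoint {e} e∈C r+2≤∣e∣
    with M , M⊆e , ∣M∣≡r+1 ← subsetOfSize (suc r) e (<⇒≤ r+2≤∣e∣)
    with a , a⊆M , 0<∣a∣ , a∈C ← dense M (≤-reflexive (sym ∣M∣≡r+1))
    = a , a △ e , 0<∣a∣ , +-cancelʳ-< (∣ a ∣ + ∣ a ∣) 0 ∣ a △ e ∣ ∣a∣+∣a∣<
    , p⊆q⇒p∩[p△q]≡⊥ a e (M⊆e ∘ a⊆M) , a∈C , △-closed a∈C e∈C
    where
    -- Adding `∣ a ∣ + ∣ a ∣` to both sides expresses that `a △ e` is nonempty without truncated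
    -- subtraction.
    ∣a∣+∣a∣< : ∣ a ∣ + ∣ a ∣ ℕ.< ∣ a △ e ∣ + (∣ a ∣ + ∣ a ∣)
    ∣a∣+∣a∣< = begin-strict
      ∣ a ∣ + ∣ a ∣                          ≤⟨ +-monoʳ-≤ ∣ a ∣ (p⊆q⇒∣p∣≤∣q∣ a⊆M) ⟩
      ∣ a ∣ + ∣ M ∣                          ≡⟨ cong₂ _+_ refl ∣M∣≡r+1 ⟩
      ∣ a ∣ + suc r                          <⟨ +-monoʳ-< ∣ a ∣ r+2≤∣e∣ ⟩
      ∣ a ∣ + ∣ e ∣                          ≡⟨ ∣p△q∣+2∣p∩q∣≡∣p∣+∣q∣ a e ⟨
      ∣ a △ e ∣ + (∣ a ∩ e ∣ + ∣ a ∩ e ∣)    ≤⟨ +-monoʳ-≤ ∣ a △ e ∣ (+-mono-≤ (∣p∩q∣≤∣p∣ a e) (∣p∩q∣≤∣p∣ a e)) ⟩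
      ∣ a △ e ∣ + (∣ a ∣ + ∣ a ∣)            ∎
      where open ≤-Reasoning

  -- Descent on the weight replaces the choice of a codeword of minimal weight: whenever the
  -- codeword `b` found is lighter than `c`, the argument restarts from `b`.
  codeword⇒disjoint : ∀ c → Acc ℕ._<_ ∣ c ∣ → 0 ℕ.< ∣ c ∣ → Code c → Pair
  codeword⇒disjoint c (acc rec) 0<∣c∣ c∈C with ≤-total ∣ c ∣ k
  ... | inj₁ ∣c∣≤k
      with b , b⊆∁c , 0<∣b∣ , b∈C ← dense (∁ c) (∣p∣≤k⇒r<∣∁p∣ c ∣c∣≤k)
      = b , c , 0<∣b∣ , 0<∣c∣ , p⊆∁q⇒p∩q≡⊥ b⊆∁c , b∈C , c∈C
  ... | inj₂ k≤∣c∣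
      -- The complement of a `k`-element set has exactly `r + 1` elements, just enough for `dense`
      -- to give a codeword avoiding `t`.
      with t , t⊆c , ∣t∣≡k ← subsetOfSize k c k≤∣c∣
      with b , b⊆∁t , 0<∣b∣ , b∈C ← dense (∁ t) (∣p∣≤k⇒r<∣∁p∣ t (≤-reflexive ∣t∣≡k))
      with ∣ b ∣ <? ∣ c ∣
  ... | yes ∣b∣<∣c∣ = codeword⇒disjoint b (rec ∣b∣<∣c∣) 0<∣b∣ b∈C
  ... | no  ∣b∣≮∣c∣ = heavyCodeword⇒disjoint (△-closed b∈C c∈C)
      (≤-trans r+2≤2k (+-cancelʳ-≤ (i + i) (k + k) ∣ b △ c ∣ 2k+2i≤))
    where
    i = ∣ b ∩ c ∣

    -- `b ∩ c` and `t` are disjoint subsets of `c`, because `b` avoids `t`.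
    i+k≤∣c∣ : i + k ℕ.≤ ∣ c ∣
    i+k≤∣c∣ = subst (λ j → i + j ℕ.≤ ∣ c ∣) ∣t∣≡k
      (disjoint-⊆⇒∣p∣+∣q∣≤∣s∣ (b ∩ c) t c (p⊆∁q⇒p∩q≡⊥ (b⊆∁t ∘ p∩q⊆p b c)) (p∩q⊆q b c) t⊆c)

    2k+2i≤ : (k + k) + (i + i) ℕ.≤ ∣ b △ c ∣ + (i + i)
    2k+2i≤ = begin
      (k + k) + (i + i)          ≡⟨ regroup k i ⟩
      (i + k) + (i + k)          ≤⟨ +-mono-≤ i+k≤∣c∣ i+k≤∣c∣ ⟩
      ∣ c ∣ + ∣ c ∣              ≤⟨ +-monoˡ-≤ ∣ c ∣ (≮⇒≥ ∣b∣≮∣c∣) ⟩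
      ∣ b ∣ + ∣ c ∣              ≡⟨ ∣p△q∣+2∣p∩q∣≡∣p∣+∣q∣ b c ⟨
      ∣ b △ c ∣ + (i + i)        ∎
      where
      open ≤-Reasoning
      regroup : ∀ k i → (k + k) + (i + i) ≡ (i + k) + (i + k)
      regroup = solve-∀

  disjointCodewords : Pair
  disjointCodewords
    with c , _ , 0<∣c∣ , c∈C ← dense ⊤ (subst (r ℕ.<_) (sym (∣⊤∣≡n _)) (s≤s (m≤m+n r k)))
    = codeword⇒disjoint c (<-wellFounded _) 0<∣c∣ c∈C

-- Disjoint zero-sum subsequences as pairs of disjoint index sets

module _ {c ℓ} (G : AbelianGroup c ℓ) where
  open AbelianGroup G using (Carrier; _≈_; _∙_; ε; setoid; assoc; comm; ∙-cong; ∙-congʳ)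
    renaming (refl to ≈-refl; sym to ≈-sym; trans to ≈-trans)
  open Permutation setoid using (_↭_; ↭-refl; ↭-trans; ↭-prep; ↭-reflexive; ↭-reflexive-≋)
  open PermutationProperties setoid using (↭-shift; ++⁺ˡ; ++⁺ʳ)
  open ListEquality setoid using (_≋_)

  select : (S : List Carrier) → Subset (length S) → List Carrier
  select []      []          = []
  select (s ∷ S) (true  ∷ x) = s ∷ select S x
  select (s ∷ S) (false ∷ x) = select S x

  ∑ : (S : List Carrier) → Subset (length S) → Carrier
  ∑ S x = foldr _∙_ ε (select S x)

  -- Index sets range over a finite type, so in this form the existence of two disjoint zero-sum
  -- subsequences can be decided by search.
  DisjointZeroSumMasks : List Carrier → Set ℓ
  DisjointZeroSumMasks S =
    ∃[ x ] ∃[ y ] 0 ℕ.< ∣ x ∣ × 0 ℕ.< ∣ y ∣ × x ∩ y ≡ ⊥ × ∑ S x ≈ ε × ∑ S y ≈ ε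

  disjointZeroSumMasks? : Decidable₂ _≈_ → Decidable DisjointZeroSumMasks
  disjointZeroSumMasks? _≈?_ S = anySubset? λ x → anySubset? λ y →
    (0 <? ∣ x ∣) ×-dec (0 <? ∣ y ∣) ×-dec Vec.≡-dec Bool._≟_ (x ∩ y) ⊥
      ×-dec (∑ S x ≈? ε) ×-dec (∑ S y ≈? ε)

  select-nonempty : ∀ S x → 0 ℕ.< ∣ x ∣ → select S x ≢ []
  select-nonempty []      []          ()
  select-nonempty (s ∷ S) (true  ∷ x) _     = λ ()
  select-nonempty (s ∷ S) (false ∷ x) 0<∣x∣ = select-nonempty S x 0<∣x∣

  -- The indices in neither set make up `U`. A head term outside the first block is moved to the
  -- front past the blocks before it.
  select-partition : ∀ S x y → x ∩ y ≡ ⊥ → ∃[ U ] select S x ++ select S y ++ U ↭ S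
  select-partition []      []          []           _     = [] , ↭-refl
  select-partition (s ∷ S) (b     ∷ x) (b′    ∷ y)  eq
    with b∧b′≡false , x∩y≡⊥ ← Vec.∷-injective eq
    with U , perm ← select-partition S x y x∩y≡⊥
    with b | b′
  ... | true  | false = U , ↭-prep s perm
  ... | false | true  = U , ↭-trans (↭-shift (select S x) _) (↭-prep s perm)
  ... | false | false = s ∷ U , ↭-trans (++⁺ˡ (select S x) (↭-shift (select S y) U))
                                (↭-trans (↭-shift (select S x) _) (↭-prep s perm))
  ... | true  | true  with () ← b∧b′≡false

  concat-pair : ∀ (T T′ U : List Carrier) → concat (T ∷ T′ ∷ []) ++ U ≡ T ++ T′ ++ U
  concat-pair T T′ U = trans (List.++-assoc T _ U) (cong (λ V → T ++ V ++ U) (List.++-identityʳ T′))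

  masks⇒disjoint : ∀ {S} → DisjointZeroSumMasks S → HasDisjointZeroSums G 2 S
  masks⇒disjoint {S} (x , y , 0<∣x∣ , 0<∣y∣ , x∩y≡⊥ , ∑x , ∑y)
    with U , perm ← select-partition S x y x∩y≡⊥
    = select S x ∷ select S y ∷ [] , refl
    , (select-nonempty S x 0<∣x∣ , ∑x) ∷ (select-nonempty S y 0<∣y∣ , ∑y) ∷ []
    , U , ↭-trans (↭-reflexive (concat-pair (select S x) (select S y) U)) perm

  -- Carrying index sets along permutations

  Transport : List Carrier → List Carrier → Set ℓ
  Transport S S′ = Σ[ π ∈ (Subset (length S) → Subset (length S′)) ]
    (∀ x → ∣ π x ∣ ≡ ∣ x ∣) × (∀ x y → x ∩ y ≡ ⊥ → π x ∩ π y ≡ ⊥) × (∀ x → ∑ S′ (π x) ≈ ∑ S x)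

  transport-prep : ∀ {s s′ S S′} → s ≈ s′ → Transport S S′ → Transport (s ∷ S) (s′ ∷ S′)
  transport-prep s≈s′ (π , ∣π∣ , π-disj , ∑π) =
      (λ { (b ∷ x) → b ∷ π x })
    , (λ { (true ∷ x) → cong suc (∣π∣ x) ; (false ∷ x) → ∣π∣ x })
    , (λ { (b ∷ x) (b′ ∷ y) eq → cong₂ _∷_ (Vec.∷-injectiveˡ eq) (π-disj x y (Vec.∷-injectiveʳ eq)) })
    , (λ { (true ∷ x) → ∙-cong (≈-sym s≈s′) (∑π x) ; (false ∷ x) → ∑π x })

  transport-swap : ∀ s t S → Transport (s ∷ t ∷ S) (t ∷ s ∷ S)
  transport-swap s t S =
      (λ { (b ∷ b′ ∷ x) → b′ ∷ b ∷ x })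
    , (λ { (true ∷ true ∷ x) → refl ; (true ∷ false ∷ x) → refl
         ; (false ∷ true ∷ x) → refl ; (false ∷ false ∷ x) → refl })
    , (λ { (b ∷ b′ ∷ x) (d ∷ d′ ∷ y) eq → let eq′ = Vec.∷-injectiveʳ eq in
           cong₂ _∷_ (Vec.∷-injectiveˡ eq′) (cong₂ _∷_ (Vec.∷-injectiveˡ eq) (Vec.∷-injectiveʳ eq′)) })
    , (λ { (true ∷ true ∷ x) → ≈-trans (≈-sym (assoc t s _)) (≈-trans (∙-congʳ (comm t s)) (assoc s t _))
         ; (true ∷ false ∷ x) → ≈-refl ; (false ∷ true ∷ x) → ≈-refl ; (false ∷ false ∷ x) → ≈-refl })

  transport-trans : ∀ S T U → Transport S T → Transport T U → Transport S U
  transport-trans S T U (π , ∣π∣ , π-disj , ∑π) (ρ , ∣ρ∣ , ρ-disj , ∑ρ) =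
      ρ ∘ π
    , (λ x → trans (∣ρ∣ (π x)) (∣π∣ x))
    , (λ x y → ρ-disj (π x) (π y) ∘ π-disj x y)
    , (λ x → ≈-trans (∑ρ (π x)) (∑π x))

  ≋⇒transport : ∀ {S S′} → S ≋ S′ → Transport S S′
  ≋⇒transport []       = (λ x → x) , (λ _ → refl) , (λ _ _ eq → eq) , (λ _ → ≈-refl)
  ≋⇒transport (e ∷ es) = transport-prep e (≋⇒transport es)

  ↭⇒transport : ∀ {S S′} → S ↭ S′ → Transport S S′
  ↭⇒transport (Permutation.refl S≋S′)    = ≋⇒transport S≋S′
  ↭⇒transport (Permutation.prep e S↭S′)  = transport-prep e (↭⇒transport S↭S′)
  -- A swap step also replaces both terms by equal ones; it factors as a plain exchange followed by
  -- two `transport-prep` steps.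
  ↭⇒transport (Permutation.swap {S} {S′} {s} {t} {s′} {t′} e f S↭S′) =
    transport-trans (s ∷ t ∷ S) (t ∷ s ∷ S) (t′ ∷ s′ ∷ S′) (transport-swap s t S)
      (transport-prep f (transport-prep e (↭⇒transport S↭S′)))
  ↭⇒transport (Permutation.trans {S} {T} {U} S↭T T↭U) =
    transport-trans S T U (↭⇒transport S↭T) (↭⇒transport T↭U)

  prefix : (T U : List Carrier) → Subset (length (T ++ U))
  prefix []      U = ⊥
  prefix (t ∷ T) U = true ∷ prefix T U

  weaken : (T U : List Carrier) → Subset (length U) → Subset (length (T ++ U))
  weaken []      U x = x
  weaken (t ∷ T) U x = false ∷ weaken T U x

  select-⊥ : ∀ U → select U ⊥ ≡ []
  select-⊥ []      = refl
  select-⊥ (u ∷ U) = select-⊥ U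

  select-prefix : ∀ T U → select (T ++ U) (prefix T U) ≡ T
  select-prefix []      U = select-⊥ U
  select-prefix (t ∷ T) U = cong (t ∷_) (select-prefix T U)

  select-weaken : ∀ T U x → select (T ++ U) (weaken T U x) ≡ select U x
  select-weaken []      U x = refl
  select-weaken (t ∷ T) U x = select-weaken T U x

  ∣weaken∣ : ∀ T U x → ∣ weaken T U x ∣ ≡ ∣ x ∣
  ∣weaken∣ []      U x = refl
  ∣weaken∣ (t ∷ T) U x = ∣weaken∣ T U x

  prefix∩weaken≡⊥ : ∀ T U x → prefix T U ∩ weaken T U x ≡ ⊥
  prefix∩weaken≡⊥ []      U x = ∩-zeroˡ x
  prefix∩weaken≡⊥ (t ∷ T) U x = cong (false ∷_) (prefix∩weaken≡⊥ T U x)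

  0<∣prefix∣ : ∀ T U → T ≢ [] → 0 ℕ.< ∣ prefix T U ∣
  0<∣prefix∣ []      U T≢[] = ⊥-elim (T≢[] refl)
  0<∣prefix∣ (t ∷ T) U _    = z<s

  -- In `T ++ T′ ++ U` the two subsequences are consecutive blocks with evident masks, which are
  -- then transported to `S` along the permutation.
  disjoint⇒masks : ∀ {S} → HasDisjointZeroSums G 2 S → DisjointZeroSumMasks S
  disjoint⇒masks {S} (T ∷ T′ ∷ [] , _ , (T≢[] , ∑T) ∷ (T′≢[] , ∑T′) ∷ [] , U , perm)
    with π , ∣π∣ , π-disj , ∑π ← ↭⇒transport (↭-trans (↭-reflexive (sym (concat-pair T T′ U))) perm)
    = π x , π y
    , subst (0 ℕ.<_) (sym (∣π∣ x)) (0<∣prefix∣ T (T′ ++ U) T≢[])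
    , subst (0 ℕ.<_) (sym (trans (∣π∣ y) (∣weaken∣ T (T′ ++ U) (prefix T′ U)))) (0<∣prefix∣ T′ U T′≢[])
    , π-disj x y (prefix∩weaken≡⊥ T (T′ ++ U) (prefix T′ U))
    , ≈-trans (∑π x) (subst (ZeroSum G) (sym (select-prefix T (T′ ++ U))) ∑T)
    , ≈-trans (∑π y) (subst (ZeroSum G)
        (sym (trans (select-weaken T (T′ ++ U) (prefix T′ U)) (select-prefix T′ U))) ∑T′)
    where
    x y : Subset (length (T ++ T′ ++ U))
    x = prefix T (T′ ++ U)
    y = weaken T (T′ ++ U) (prefix T′ U)

  -- Decidability of the property defining the constant

  hasDisjointZeroSums? : Decidable₂ _≈_ → Decidable (HasDisjointZeroSums G 2)
  hasDisjointZeroSums? _≈?_ S = map′ masks⇒disjoint disjoint⇒masks (disjointZeroSumMasks? _≈?_ S)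

  hasDisjointZeroSums-resp-≋ : ∀ {k S S′} → S ≋ S′ → HasDisjointZeroSums G k S → HasDisjointZeroSums G k S′
  hasDisjointZeroSums-resp-≋ S≋S′ (Ts , ∣Ts∣≡k , zs , U , perm) =
    Ts , ∣Ts∣≡k , zs , U , ↭-trans perm (↭-reflexive-≋ S≋S′)

  hasDisjointZeroSums-++ : ∀ {k} S V → HasDisjointZeroSums G k S → HasDisjointZeroSums G k (S ++ V)
  hasDisjointZeroSums-++ S V (Ts , ∣Ts∣≡k , zs , U , perm) = Ts , ∣Ts∣≡k , zs , U ++ V ,
    ↭-trans (↭-reflexive (sym (List.++-assoc (concat Ts) U V))) (++⁺ʳ V perm)

  allOfLength⇒allLong : ∀ {k n} → (∀ S → length S ≡ n → HasDisjointZeroSums G k S) →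
                        AllLongHaveDisjointZeroSums G k n
  allOfLength⇒allLong {k} {n} all S n≤∣S∣ = subst (HasDisjointZeroSums G k) (List.take++drop≡id n S)
    (hasDisjointZeroSums-++ (take n S) (drop n S)
      (all (take n S) (trans (List.length-take n S) (m≤n⇒m⊓n≡m n≤∣S∣))))

  -- The carrier is only required to be finite up to _≈_.
  Searchable : Set _
  Searchable = ∀ {P : Carrier → Set (c ⊔ ℓ)} → (∀ {g h} → g ≈ h → P g → P h) →
               Decidable P → Dec (∀ g → P g)

  allOfLength? : Searchable → ∀ n {P : List Carrier → Set (c ⊔ ℓ)} → (∀ {S S′} → S ≋ S′ → P S → P S′) →
                 Decidable P → Dec (∀ S → length S ≡ n → P S)
  allOfLength? ∀? zero    resp P? = map′ (λ { P[] [] _ → P[] }) (λ all → all [] refl) (P? [])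
  allOfLength? ∀? (suc n) resp P? =
    map′ (λ { all (g ∷ S) eq → all g S (suc-injective eq) }) (λ all g S eq → all (g ∷ S) (cong suc eq))
      (∀? (λ g≈h all S eq → resp (g≈h ∷ ListEquality.≋-refl setoid) (all S eq))
          (λ g → allOfLength? ∀? n (λ S≋S′ → resp (≈-refl ∷ S≋S′)) (P? ∘ (g ∷_))))

  -- This decision procedure lets `least` produce the exact value of the constant constructively,
  -- once some bound is known.
  allLong? : Decidable₂ _≈_ → Searchable → Decidable (AllLongHaveDisjointZeroSums G 2)
  allLong? _≈?_ ∀? n = map′ allOfLength⇒allLong (λ all S eq → all S (≤-reflexive (sym eq)))
    (allOfLength? ∀? n hasDisjointZeroSums-resp-≋ (hasDisjointZeroSums? _≈?_))

-- Elementary abelian 2-groups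

∀-Parity? : {P : Parity → Set p} → Decidable P → Dec (∀ b → P b)
∀-Parity? P? = map′ (λ { (P0 , P1) 0ℙ → P0 ; (P0 , P1) 1ℙ → P1 }) (λ all → all 0ℙ , all 1ℙ)
  (P? 0ℙ ×-dec P? 1ℙ)

-- Group elements are functions, compared pointwise. Each agrees pointwise with one assembled from
-- its finitely many values, and `resp` carries the predicate across.
∀-C₂^? : ∀ r → Searchable (C₂^ r)
∀-C₂^? zero    resp P? = map′ (λ Pg g → resp (λ ()) Pg) (λ all → all _) (P? (λ ()))
∀-C₂^? (suc r) {P} resp P? =
  map′ (λ all g → resp (λ { zero → refl ; (suc j) → refl }) (all (g zero) (g ∘ suc))) (λ all b g → all (cons b g))
    (∀-Parity? λ b → ∀-C₂^? r (λ g≈h → resp (λ { zero → refl ; (suc j) → g≈h j })) (P? ∘ cons b))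
  where
  cons : Parity → (Fin r → Parity) → Fin (suc r) → Parity
  cons b g zero    = b
  cons b g (suc j) = g j

least : {P : ℕ → Set p} → Decidable P → ∀ n → P n → ∃[ d ] d ℕ.≤ n × P d × (∀ i → P i → d ℕ.≤ i)
least P? n Pn with P? 0
least P? n       Pn | yes P0 = 0 , z≤n , P0 , λ _ _ → z≤n
least P? zero    P0 | no ¬P0 = ⊥-elim (¬P0 P0)
least P? (suc n) Pn | no ¬P0 with d , d≤n , Pd , d-min ← least (P? ∘ suc) n Pn
  = suc d , s≤s d≤n , Pd , λ { zero P0 → ⊥-elim (¬P0 P0) ; (suc i) Pi → s≤s (d-min i Pi) }

-- A term chosen by both masks is absent from the symmetric difference and occurs twice on the other
-- side, where it cancels modulo 2.
∑-linear : ∀ S j → LinearForm (λ x → ∑ (C₂^ r) S x j)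
∑-linear []      j []          []          = refl
∑-linear (s ∷ S) j (true  ∷ x) (true  ∷ y) = trans (∑-linear S j x y) (cancel (s j) (∑ _ S x j) (∑ _ S y j))
  where
  cancel : ∀ p q q′ → q ℙ.+ q′ ≡ (p ℙ.+ q) ℙ.+ (p ℙ.+ q′)
  cancel 0ℙ q  q′ = refl
  cancel 1ℙ 0ℙ 0ℙ = refl
  cancel 1ℙ 0ℙ 1ℙ = refl
  cancel 1ℙ 1ℙ 0ℙ = refl
  cancel 1ℙ 1ℙ 1ℙ = refl
∑-linear (s ∷ S) j (true  ∷ x) (false ∷ y) = trans (cong (s j ℙ.+_) (∑-linear S j x y)) (sym (ℙ.+-assoc (s j) _ _))
∑-linear (s ∷ S) j (false ∷ x) (true  ∷ y) = trans (cong (s j ℙ.+_) (∑-linear S j x y))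
  (trans (sym (ℙ.+-assoc (s j) (∑ _ S x j) (∑ _ S y j)))
  (trans (cong (ℙ._+ ∑ _ S y j) (ℙ.+-comm (s j) (∑ _ S x j))) (ℙ.+-assoc (∑ _ S x j) (s j) _)))
∑-linear (s ∷ S) j (false ∷ x) (false ∷ y) = ∑-linear S j x y

-- The upper bound

disjointZeros : (φ : Subset n → Fin r → Parity) → (∀ j → LinearForm (λ x → φ x j)) → 3 * r + 4 ℕ.≤ n + n →
                ∃[ x ] ∃[ y ] 0 ℕ.< ∣ x ∣ × 0 ℕ.< ∣ y ∣ × x ∩ y ≡ ⊥ × (∀ j → φ x j ≡ 0ℙ) × (∀ j → φ y j ≡ 0ℙ)
disjointZeros {n} {r} φ φ-lin 3r+4≤2n with ≤-<-connex n r
... | inj₁ n≤r = ⊥-elim (<⇒≱ 2r<3r+4 (≤-trans 3r+4≤2n (+-mono-≤ n≤r n≤r)))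
  where
  identity : ∀ r → suc (r + r) + (3 + r) ≡ 3 * r + 4
  identity = solve-∀

  2r<3r+4 : r + r ℕ.< 3 * r + 4
  2r<3r+4 = subst (r + r ℕ.<_) (identity r) (m≤m+n _ _)
... | inj₂ r<n with k , refl ← m≤n⇒∃[o]m+o≡n r<n =
  disjointCodewords (λ x → ∀ j → φ x j ≡ 0ℙ)
    (λ {x} {y} φx φy j → trans (φ-lin j x y) (cong₂ ℙ._+_ (φx j) (φy j)))
    (commonZeroInside φ φ-lin)
    -- With `n = suc r + k`, removing `2 + (r + r)` from both sides of `3 * r + 4 ≤ n + n` leaves
    -- exactly `2 + r ≤ k + k`.
    (+-cancelˡ-≤ (2 + (r + r)) _ _ (subst₂ ℕ._≤_ (left r) (right r k) 3r+4≤2n))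
  where
  left : ∀ r → 3 * r + 4 ≡ 2 + (r + r) + (2 + r)
  left = solve-∀

  right : ∀ r k → suc r + k + (suc r + k) ≡ 2 + (r + r) + (k + k)
  right = solve-∀

allLong-C₂^ : ∀ r n → 3 * r + 4 ℕ.≤ n + n → AllLongHaveDisjointZeroSums (C₂^ r) 2 n
allLong-C₂^ r n 3r+4≤2n S n≤∣S∣ = masks⇒disjoint (C₂^ r)
  (disjointZeros (∑ (C₂^ r) S) (∑-linear S) (≤-trans 3r+4≤2n (+-mono-≤ n≤∣S∣ n≤∣S∣)))

n≤2⌈n/2⌉ : ∀ n → n ℕ.≤ ⌈ n /2⌉ + ⌈ n /2⌉
n≤2⌈n/2⌉ n = subst (ℕ._≤ ⌈ n /2⌉ + ⌈ n /2⌉) (⌊n/2⌋+⌈n/2⌉≡n n) (+-monoˡ-≤ ⌈ n /2⌉ (⌊n/2⌋≤⌈n/2⌉ n))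

2⌈n/2⌉≤1+n : ∀ n → ⌈ n /2⌉ + ⌈ n /2⌉ ℕ.≤ suc n
2⌈n/2⌉≤1+n n = subst (⌈ n /2⌉ + ⌈ n /2⌉ ℕ.≤_) (⌊n/2⌋+⌈n/2⌉≡n (suc n)) (+-monoʳ-≤ ⌈ n /2⌉ (⌊n/2⌋≤⌈n/2⌉ (suc n)))

-- The fraction `+ n / 2` need not be in lowest terms, so the cross-multiplication is done on
-- unnormalised rationals.
m+m<n⇒m/1<n/2 : ∀ m n → m + m ℕ.< n → (+ m / 1) < (+ n / 2)
m+m<n⇒m/1<n/2 m n m+m<n = ℚ.toℚᵘ-cancel-<
  (ℚᵘ.<-respˡ-≃ (ℚᵘ.≃-sym (ℚ.toℚᵘ-fromℚᵘ (ℚᵘ.mkℚᵘ (+ m) 0)))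
  (ℚᵘ.<-respʳ-≃ (ℚᵘ.≃-sym (ℚ.toℚᵘ-fromℚᵘ (ℚᵘ.mkℚᵘ (+ n) 1)))
  (ℚᵘ.*<* (subst₂ ℤ._<_ (trans (cong +_ (double m)) (ℤ.pos-* m 2)) (sym (ℤ.*-identityʳ (+ n))) (ℤ.+<+ m+m<n)))))
  where
  double : ∀ m → m + m ≡ m * 2
  double = solve-∀

theorem7p8 : (r : ℕ) → ∃[ d ] IsD (C₂^ r) 2 d × (+ d / 1) < (+ (3 * r + 6) / 2)
theorem7p8 r
  -- The search is bounded by the least `n` with `3 * r + 4 ≤ n + n`. Rounding up costs at most one,
  -- so `d + d` is at most `3 * r + 5`, which gives the strict inequality.
  with d , d≤N , Pd , d-min ← least (allLong? (C₂^ r) (λ g h → Fin.all? (λ j → g j ℙ.≟ h j)) (∀-C₂^? r))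
         ⌈ 3 * r + 4 /2⌉ (allLong-C₂^ r _ (n≤2⌈n/2⌉ (3 * r + 4)))
  = d , (Pd , d-min) , m+m<n⇒m/1<n/2 d (3 * r + 6) (begin-strict
    d + d                                ≤⟨ +-mono-≤ d≤N d≤N ⟩
    ⌈ 3 * r + 4 /2⌉ + ⌈ 3 * r + 4 /2⌉    ≤⟨ 2⌈n/2⌉≤1+n (3 * r + 4) ⟩
    suc (3 * r + 4)                      <⟨ ≤-reflexive (bound r) ⟩
    3 * r + 6                            ∎)
  where
  open ≤-Reasoning
  bound : ∀ r → suc (suc (3 * r + 4)) ≡ 3 * r + 6
  bound = solve-∀
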